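{- For all $n$, \[\mathrm{ex}_o(n,R_3) = \left\lfloor \frac{n}{2} \right\rfloor \left\lceil \frac{n}{2} \right\rceil \frac{n-2}{2}.\] Moreover, for each $n$ there is exactly one $R_3$-free oriented graph on $n$ vertices with this many edges, up to isomorphism.
   Context: A $2\to1$ directed hypergraph (here simply a "graph") is a pair $H=(V,E)$ with $V$ a finite vertex set and $E$ a set of edges, each edge being a 3-element subset $\{a,b,c\}$ of $V$ with one element marked as the head; the edge with underlying set $\{a,b,c\}$ and head $c$ is written $ab \to c$. $H$ is oriented if every 3-subset of $V$ carries at most one edge. A homomorphism $\phi:F\to G$ is a map $V(F)\to V(G)$ with $ab\to c\in E(F)\Rightarrow \phi(a)\phi(b)\to\phi(c)\in E(G)$. $G$ is $F$-free if there is no injective homomorphism $F\to G$. $\mathrm{ex}_o(n,F)$ is the maximum number of edges of an $F$-free oriented graph on $n$ vertices. $R_3$ is the graph with vertex set $\{a,b,c,d\}$ and edge set $\{ab\to c,\ bc\to d\}$. -}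

module Defs where

open import Data.Nat using (ℕ; zero; suc; _+_; _*_; _∸_; _≤_; _<ᵇ_)
open import Data.Nat.DivMod using (_/_)
open import Data.Bool using (Bool; true; false; _∧_; if_then_else_)
open import Data.Fin using (Fin; toℕ) renaming (zero to f0; suc to fs)
open import Data.List using (List; map; allFin)
open import Data.Nat.ListAction using (sum)
open import Data.Product using (Σ; _×_; ∃)
open import Data.Empty using (⊥)
open import Relation.Binary.PropositionalEquality using (_≡_; _≢_)
open import Function.Bundles using (_↔_; Inverse)
open import Function.Definitions using (Injective)

-- A (2→1 directed) hypergraph on vertex set Fin n, given by its edge
-- indicator: E a b c ≡ true means the edge  ab → c  (underlying set {a,b,c},
-- head c) is present.
Rel3 : ℕ → Set
Rel3 n = Fin n → Fin n → Fin n → Bool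

IsGraph : ∀ {n} → Rel3 n → Set
IsGraph {n} E =
  (∀ a b c → E a b c ≡ true → (a ≢ b) × (a ≢ c) × (b ≢ c)) ×
  (∀ a b c → E a b c ≡ E b a c)

-- Oriented: each 3-set carries at most one edge (no two edges with distinct
-- heads on the same 3-set; with the symmetry above these cases cover all).
IsOriented : ∀ {n} → Rel3 n → Set
IsOriented {n} E =
  (∀ a b c → E a b c ≡ true → E a c b ≡ true → ⊥) ×
  (∀ a b c → E a b c ≡ true → E b c a ≡ true → ⊥)

IsHom : ∀ {m n} → Rel3 m → Rel3 n → (Fin m → Fin n) → Set
IsHom {m} F G φ = ∀ a b c → F a b c ≡ true → G (φ a) (φ b) (φ c) ≡ true

Free : ∀ {m n} → Rel3 m → Rel3 n → Set
Free {m} {n} F G = (φ : Fin m → Fin n) → Injective _≡_ _≡_ φ → IsHom F G φ → ⊥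

-- R₃ on {a,b,c,d} = {0,1,2,3}: edges ab → c and bc → d.
R3 : Rel3 4
R3 f0 (fs f0) (fs (fs f0)) = true
R3 (fs f0) f0 (fs (fs f0)) = true
R3 (fs f0) (fs (fs f0)) (fs (fs (fs f0))) = true
R3 (fs (fs f0)) (fs f0) (fs (fs (fs f0))) = true
R3 _ _ _ = false

numEdges : ∀ {n} → Rel3 n → ℕ
numEdges {n} E =
  sum (map (λ a → sum (map (λ b → sum (map (λ c →
    if (toℕ a <ᵇ toℕ b) ∧ E a b c then 1 else 0)
    (allFin n))) (allFin n))) (allFin n))

Isomorphic : ∀ {n} → Rel3 n → Rel3 n → Set
Isomorphic {n} G H =
  Σ (Fin n ↔ Fin n) λ σ →
    ∀ a b c → G a b c ≡ H (Inverse.to σ a) (Inverse.to σ b) (Inverse.to σ c)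

-- ⌊n/2⌋ ⌈n/2⌉ (n-2)/2  (an integer; equals 0 for n ≤ 2).
exValue : ℕ → ℕ
exValue n = ((n / 2) * ((n + 1) / 2) * (n ∸ 2)) / 2

R3FreeOriented : ∀ {n} → Rel3 n → Set
R3FreeOriented G = IsGraph G × IsOriented G × Free R3 G

{-# OPTIONS --safe #-}
-- Freeness and orientedness together forbid ab → c and bc → d for all a, d, so no pair is both a tail
-- and a tail–head pair. Call two vertices related when they are equal or form a tail; then every
-- edge ab → c has a, b related and c related to neither, and G lies in the graph of all such edges.
-- If a is related to deg a other vertices and unrelated to codeg a, the number of ordered edges of that
-- graph plus the number of failures of transitivity is ∑ deg a * codeg a. For even n bounding each
-- product suffices. For odd n = 2k + 1 a further k must be saved: if some v has degree k, each of the
-- k vertices unrelated to v either has degree ≠ k or fails transitivity with v. In the case of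
-- equality, being related is an equivalence relation with two classes of sizes ⌊n/2⌋ and ⌈n/2⌉.
module Submission where

open import Defs
open import Algebra.Properties.Semiring.Sum using ()
import Data.Bool as Bool
open import Data.Bool using (Bool; true; false; _∧_; _∨_; not; if_then_else_)
open import Data.Bool.Properties using (not-injective; not-involutive; ∧-comm; ∧-zeroʳ; ∨-zeroʳ)
open import Data.Empty using (⊥; ⊥-elim)
open import Data.Fin using (Fin; zero; suc; toℕ; punchOut)
open import Data.Fin.Patterns using (0F; 1F; 2F; 3F)
open import Data.Fin.Permutation using (Permutation; _⟨$⟩ʳ_; insert; insert-punchIn)
open import Data.Fin.Properties using (_≟_; any?; injective⇒≤; punchIn-punchOut; toℕ-injective)
open import Data.List using (map; allFin)
open import Data.List.Properties using (map-tabulate)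
open import Data.Nat using (ℕ; zero; suc; _+_; _*_; _∸_; _≤_; _<_; _<ᵇ_; z≤n; s≤s; ∣_-_∣)
open import Data.Nat.DivMod using (_/_; m*n/n≡m; +-distrib-/-∣ʳ)
open import Data.Nat.Divisibility using (n∣m*n)
import Data.Nat.ListAction as List
open import Data.Nat.Properties hiding (_≟_)
import Data.Nat.Properties as ℕ
open import Data.Nat.Solver using (module +-*-Solver)
open import Data.Product using (Σ; _×_; _,_; proj₁; proj₂; ∃)
open import Data.Sum using (_⊎_; inj₁; inj₂)
open import Data.Vec using (lookup; _∷_; [])
import Data.Vec.Functional as Vector
open import Data.Vec.Functional using (removeAt)
open import Data.Vec.Relation.Unary.All using ([]; _∷_)
open import Data.Vec.Relation.Unary.AllPairs using ([]; _∷_)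
open import Data.Vec.Relation.Unary.Unique.Propositional.Properties using (lookup-injective)
open import Function using (_∘_; id; mk⇔)
open import Function.Bundles using (Inverse)
open import Relation.Binary.PropositionalEquality
open import Relation.Nullary using (Dec; yes; no; does; contradiction)
open import Relation.Nullary.Decidable using (dec-true; dec-false; does-⇔)

open Algebra.Properties.Semiring.Sum +-*-semiring using (sum; sum-cong-≗; ∑-distrib-+; ∑-comm; sum-remove; *-distribˡ-sum; *-distribʳ-sum)
open +-*-Solver using (solve; con; _:+_; _:*_; _:=_)

private variable
  n : ℕ

-- Sums of natural numbers over a finite index set.

sum-mono-≤ : {f g : Fin n → ℕ} → (∀ i → f i ≤ g i) → sum f ≤ sum g
sum-mono-≤ {zero}  f≤g = z≤n
sum-mono-≤ {suc n} f≤g = +-mono-≤ (f≤g zero) (sum-mono-≤ (f≤g ∘ suc))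

-- The equality case of `sum-mono-≤`: a bound found by summing termwise bounds is attained only if
-- every term attains its own.
sum-squeeze : {f g : Fin n → ℕ} → (∀ i → f i ≤ g i) → sum g ≤ sum f → ∀ i → f i ≡ g i
sum-squeeze {suc n} {f} {g} f≤g Σg≤Σf zero =
  ≤-antisym (f≤g zero)
    (+-cancelʳ-≤ (sum (f ∘ suc)) (g zero) (f zero)
      (≤-trans (+-monoʳ-≤ (g zero) (sum-mono-≤ (f≤g ∘ suc))) Σg≤Σf))
sum-squeeze {suc n} {f} {g} f≤g Σg≤Σf (suc i) =
  sum-squeeze (f≤g ∘ suc)
    (+-cancelˡ-≤ (g zero) (sum (g ∘ suc)) (sum (f ∘ suc))
      (≤-trans Σg≤Σf (+-monoˡ-≤ (sum (f ∘ suc)) (f≤g zero)))) i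

sum-const : ∀ n c → sum {n} (λ _ → c) ≡ n * c
sum-const zero    c = refl
sum-const (suc n) c = cong (c +_) (sum-const n c)

sum-zero : ∀ n → sum {n} (λ _ → 0) ≡ 0
sum-zero n = trans (sum-const n 0) (*-zeroʳ n)

term≤sum : (f : Fin n → ℕ) (i : Fin n) → f i ≤ sum f
term≤sum f zero    = m≤m+n _ _
term≤sum f (suc i) = ≤-trans (term≤sum (f ∘ suc) i) (m≤n+m _ _)

term+term≤sum : (f : Fin n → ℕ) {i j : Fin n} → i ≢ j → f i + f j ≤ sum f
term+term≤sum {suc n} f {i} {j} i≢j = begin
  f i + f j                                 ≡⟨ cong (λ k → f i + f k) (punchIn-punchOut i≢j) ⟨
  f i + removeAt f i (punchOut i≢j)         ≤⟨ +-monoʳ-≤ (f i) (term≤sum (removeAt f i) (punchOut i≢j)) ⟩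
  f i + sum (removeAt f i)                  ≡⟨ sum-remove {i = i} f ⟨
  sum f                                     ∎
  where open ≤-Reasoning

sum≡0⇒term≡0 : (f : Fin n → ℕ) → sum f ≡ 0 → ∀ i → f i ≡ 0
sum≡0⇒term≡0 f Σ≡0 i = n≤0⇒n≡0 (≤-trans (term≤sum f i) (≤-reflexive Σ≡0))

sum-*-sum : ∀ {m} (f : Fin m → ℕ) (g : Fin n → ℕ) → sum f * sum g ≡ sum (λ i → sum (λ j → f i * g j))
sum-*-sum f g = trans (*-distribʳ-sum (sum g) f) (sum-cong-≗ (λ i → *-distribˡ-sum (f i) g))

sum-allFin : (f : Fin n → ℕ) → List.sum (map f (allFin n)) ≡ sum f
sum-allFin {zero}  f = refl
sum-allFin {suc n} f = cong (f zero +_) (trans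
  (cong List.sum (trans (map-tabulate suc f) (sym (map-tabulate id (f ∘ suc)))))
  (sum-allFin (f ∘ suc)))

-- Indicators and counting.

⟦_⟧ : Bool → ℕ
⟦ b ⟧ = if b then 1 else 0

⟦⟧≡0⇒false : ∀ {b} → ⟦ b ⟧ ≡ 0 → b ≡ false
⟦⟧≡0⇒false {false} _ = refl

⟦⟧-injective : ∀ {x y} → ⟦ x ⟧ ≡ ⟦ y ⟧ → x ≡ y
⟦⟧-injective {true}  {true}  _ = refl
⟦⟧-injective {false} {false} _ = refl

⟦⟧-∧ : ∀ x y → ⟦ x ∧ y ⟧ ≡ ⟦ x ⟧ * ⟦ y ⟧
⟦⟧-∧ true  y = sym (+-identityʳ ⟦ y ⟧)
⟦⟧-∧ false y = refl

⟦⟧-not : ∀ x → ⟦ x ⟧ + ⟦ not x ⟧ ≡ 1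
⟦⟧-not true  = refl
⟦⟧-not false = refl

⟦⟧≤1 : ∀ b → ⟦ b ⟧ ≤ 1
⟦⟧≤1 true  = ≤-refl
⟦⟧≤1 false = z≤n

⟦not⟧≤ : ∀ {b m} → (b ≡ false → 1 ≤ m) → ⟦ not b ⟧ ≤ m
⟦not⟧≤ {true}  _   = z≤n
⟦not⟧≤ {false} 1≤m = 1≤m refl

count : (Fin n → Bool) → ℕ
count p = sum (λ i → ⟦ p i ⟧)

count-not : (p : Fin n → Bool) → count p + count (not ∘ p) ≡ n
count-not {n} p = trans (sym (∑-distrib-+ {n} _ _))
  (trans (sum-cong-≗ {n} (λ i → ⟦⟧-not (p i))) (trans (sum-const n 1) (*-identityʳ n)))

_≡ᵇ_ : Fin n → Fin n → Bool
i ≡ᵇ j = does (i ≟ j)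

count-≡ᵇ : (i : Fin n) → count (i ≡ᵇ_) ≡ 1
count-≡ᵇ {suc n} zero    = cong suc (sum-zero n)
count-≡ᵇ         (suc i) = count-≡ᵇ i

count-witness : (p : Fin n → Bool) {m : ℕ} → count p ≡ suc m → ∃ λ i → p i ≡ true
count-witness {suc n} p eq with p zero in p₀
... | true  = zero , p₀
... | false with i , pᵢ ← count-witness (p ∘ suc) eq = suc i , pᵢ

-- Permutations between predicates of equal count.

module _ where
  open ≡-Reasoning

  count-not-cong : (p q : Fin n → Bool) → count p ≡ count q → count (not ∘ p) ≡ count (not ∘ q)
  count-not-cong {n} p q eq = +-cancelˡ-≡ (count q) _ _ (begin
    count q + count (not ∘ p)  ≡⟨ cong (_+ count (not ∘ p)) eq ⟨
    count p + count (not ∘ p)  ≡⟨ count-not p ⟩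
    n                          ≡⟨ count-not q ⟨
    count q + count (not ∘ q)  ∎)

  -- Supplies the image of zero for the induction below. If `p zero` is true, the count of `q` is
  -- positive; if it is false, the complements, whose counts also agree, have positive counts.
  matching-value : (p q : Fin (suc n) → Bool) → count p ≡ count q → ∃ λ j → p zero ≡ q j
  matching-value p q eq with p zero in p₀
  ... | true  with j , qⱼ ← count-witness q (sym eq) = j , sym qⱼ
  ... | false
    with j , ¬qⱼ ← count-witness (not ∘ q) (trans (sym (count-not-cong p q (trans (cong (λ b → ⟦ b ⟧ + count (p ∘ suc)) p₀) eq)))
                      (cong (λ b → ⟦ not b ⟧ + count (not ∘ p ∘ suc)) p₀))
    = j , not-injective (sym ¬qⱼ)

  -- Send zero to the matching index j and delete j from `q`; cancelling the two equal terms leaves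
  -- equal counts for the induction.
  permutation-of-equal-count : (p q : Fin n → Bool) → count p ≡ count q →
    Σ (Permutation n n) λ π → ∀ i → p i ≡ q (π ⟨$⟩ʳ i)
  permutation-of-equal-count {zero}  p q eq = Data.Fin.Permutation.id , λ ()
  permutation-of-equal-count {suc n} p q eq = insert zero j π , λ
    { zero    → p₀≡qⱼ
    ; (suc i) → trans (pπ i) (cong q (sym (insert-punchIn zero j π i))) }
    where
    j = proj₁ (matching-value p q eq)
    p₀≡qⱼ = proj₂ (matching-value p q eq)
    rest : count (p ∘ suc) ≡ count (removeAt q j)
    rest = +-cancelˡ-≡ ⟦ p zero ⟧ _ _ (begin
      count p                                ≡⟨ eq ⟩
      count q                                ≡⟨ sum-remove {i = j} (λ i → ⟦ q i ⟧) ⟩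
      ⟦ q j ⟧ + count (removeAt q j)         ≡⟨ cong (λ b → ⟦ b ⟧ + count (removeAt q j)) p₀≡qⱼ ⟨
      ⟦ p zero ⟧ + count (removeAt q j)      ∎)
    π = proj₁ (permutation-of-equal-count (p ∘ suc) (removeAt q j) rest)
    pπ = proj₂ (permutation-of-equal-count (p ∘ suc) (removeAt q j) rest)

-- Edges counted with ordered tails.

orderedCount : Rel3 n → ℕ
orderedCount E = sum (λ a → sum (λ b → sum (λ c → ⟦ E a b c ⟧)))

<ᵇ-trichotomy : ∀ {l m} → l ≢ m → ⟦ l <ᵇ m ⟧ + ⟦ m <ᵇ l ⟧ ≡ 1
<ᵇ-trichotomy {zero}  {zero}  l≢m = contradiction refl l≢m
<ᵇ-trichotomy {zero}  {suc m} l≢m = refl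
<ᵇ-trichotomy {suc l} {zero}  l≢m = refl
<ᵇ-trichotomy {suc l} {suc m} l≢m = <ᵇ-trichotomy (l≢m ∘ cong suc)

irreflexive : {E : Rel3 n} → IsGraph E → ∀ a c → E a a c ≡ false
irreflexive {E = E} (distinct , _) a c with E a a c in eq
... | true  = contradiction refl (proj₁ (distinct a a c eq))
... | false = refl

-- An edge with tails a and b occurs in the ordered sum as (a, b) and as (b, a), of which `numEdges`
-- keeps one. Pairs with a = b carry no edge.
orderedCount≡2*numEdges : {E : Rel3 n} → IsGraph E → orderedCount E ≡ numEdges E * 2
orderedCount≡2*numEdges {n} {E} graph@(_ , swap) = sym (begin
  numEdges E * 2                                                              ≡⟨ *-comm (numEdges E) 2 ⟩
  -- Exchanging the sums in the second copy lets it stand for the pairs with b before a.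
  numEdges E + (numEdges E + 0)                                               ≡⟨ cong₂ _+_ flat (trans (+-identityʳ _) (trans flat (∑-comm (λ a b → lower a b)))) ⟩
  sum (λ a → sum (λ b → lower a b)) + sum (λ b → sum (λ a → lower a b))       ≡⟨ ∑-distrib-+ {n} _ _ ⟨
  sum (λ a → sum (λ b → lower a b) + sum (λ b → lower b a))                   ≡⟨ sum-cong-≗ {n} (λ a → trans (sym (∑-distrib-+ {n} _ _)) (sum-cong-≗ {n} (λ b → trans (sym (∑-distrib-+ {n} _ _)) (sum-cong-≗ {n} (pointwise a b))))) ⟩
  orderedCount E                                                              ∎)
  where
  open ≡-Reasoning
  lower : Fin n → Fin n → ℕ
  lower a b = sum (λ c → ⟦ (toℕ a <ᵇ toℕ b) ∧ E a b c ⟧)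
  flat : numEdges E ≡ sum (λ a → sum (λ b → lower a b))
  flat = trans (sum-allFin {n} _) (sum-cong-≗ {n} (λ a → trans (sum-allFin {n} _) (sum-cong-≗ {n} (λ b → sum-allFin {n} _))))
  pointwise : ∀ a b c → ⟦ (toℕ a <ᵇ toℕ b) ∧ E a b c ⟧ + ⟦ (toℕ b <ᵇ toℕ a) ∧ E b a c ⟧ ≡ ⟦ E a b c ⟧
  pointwise a b c rewrite ⟦⟧-∧ (toℕ a <ᵇ toℕ b) (E a b c) | ⟦⟧-∧ (toℕ b <ᵇ toℕ a) (E b a c) | swap b a c
    with a ≟ b
  ... | yes refl rewrite irreflexive {E = E} graph a c | *-zeroʳ ⟦ toℕ a <ᵇ toℕ a ⟧ = refl
  ... | no a≢b = trans (sym (*-distribʳ-+ ⟦ E a b c ⟧ ⟦ toℕ a <ᵇ toℕ b ⟧ ⟦ toℕ b <ᵇ toℕ a ⟧))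
        (trans (cong (_* ⟦ E a b c ⟧) (<ᵇ-trichotomy (a≢b ∘ toℕ-injective))) (+-identityʳ _))

-- The graph defined by a relation.

true≢false : {b : Bool} → b ≡ true → b ≡ false → ⊥
true≢false refl ()

≢true⇒≡false : {b : Bool} → (b ≡ true → ⊥) → b ≡ false
≢true⇒≡false {true}  ¬b = contradiction refl ¬b
≢true⇒≡false {false} ¬b = refl

-- Equal tails are excluded explicitly: for a reflexive relation the degenerate triples a, a, c
-- could pass the other tests.
graphOf : (Fin n → Fin n → Bool) → Rel3 n
graphOf r a b c = not (a ≡ᵇ b) ∧ r a b ∧ not (r a c) ∧ not (r b c)

module _ (r : Fin n → Fin n → Bool) where

  graphOf⁻ : ∀ a b c → graphOf r a b c ≡ true →
    a ≢ b × r a b ≡ true × r a c ≡ false × r b c ≡ false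
  graphOf⁻ a b c e with a ≟ b | r a b | r a c | r b c
  graphOf⁻ _ _ _ e | no a≢b | true | false | false = a≢b , refl , refl , refl

  graphOf⁺ : ∀ {a b c} → a ≢ b → r a b ≡ true → r a c ≡ false → r b c ≡ false →
    graphOf r a b c ≡ true
  graphOf⁺ {a} {b} a≢b rab rac rbc rewrite dec-false (a ≟ b) a≢b | rab | rac | rbc = refl

  -- An edge ab → c leaves b and c unrelated, whereas bc → d needs them related. Taking d = a in
  -- this clash settles the cyclic half of orientedness.
  graphOf-R3FreeOriented : (∀ a → r a a ≡ true) → (∀ a b → r a b ≡ r b a) → R3FreeOriented (graphOf r)
  graphOf-R3FreeOriented r-refl r-sym = (distinct , symmetric) , (oriented₁ , oriented₂) , free
    where
    distinct : ∀ a b c → graphOf r a b c ≡ true → a ≢ b × a ≢ c × b ≢ c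
    distinct a b c e with a≢b , _ , rac , rbc ← graphOf⁻ a b c e =
      a≢b , (λ { refl → true≢false (r-refl a) rac }) , (λ { refl → true≢false (r-refl b) rbc })
    symmetric : ∀ a b c → graphOf r a b c ≡ graphOf r b a c
    symmetric a b c with a ≟ b
    ... | yes refl rewrite dec-true (a ≟ a) refl = refl
    ... | no a≢b rewrite dec-false (b ≟ a) (a≢b ∘ sym) | r-sym a b | ∧-comm (not (r a c)) (not (r b c)) = refl
    oriented₁ : ∀ a b c → graphOf r a b c ≡ true → graphOf r a c b ≡ true → ⊥
    oriented₁ a b c e e′ = true≢false (proj₁ (proj₂ (graphOf⁻ a c b e′))) (proj₁ (proj₂ (proj₂ (graphOf⁻ a b c e))))
    path-free : ∀ a b c d → graphOf r a b c ≡ true → graphOf r b c d ≡ true → ⊥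
    path-free a b c d e e′ = true≢false (proj₁ (proj₂ (graphOf⁻ b c d e′))) (proj₂ (proj₂ (proj₂ (graphOf⁻ a b c e))))
    oriented₂ : ∀ a b c → graphOf r a b c ≡ true → graphOf r b c a ≡ true → ⊥
    oriented₂ a b c = path-free a b c a
    free : Free R3 (graphOf r)
    free φ _ hom = path-free (φ 0F) (φ 1F) (φ 2F) (φ 3F)
      (hom 0F 1F 2F refl)
      (hom 1F 2F 3F refl)

-- Absence of paths ab → c, bc → d.

module _ {E : Rel3 n} (fo : R3FreeOriented E) where
  private
    distinct = proj₁ (proj₁ fo)
    swap     = proj₂ (proj₁ fo)

  -- If d = a, both edges lie on one 3-set and orientedness excludes them. Any other coincidence
  -- would occur within a single edge, so otherwise the four vertices are distinct and carry a copy
  -- of R₃.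
  R3-free⇒path-free : ∀ {a b c d} → E a b c ≡ true → E b c d ≡ true → ⊥
  R3-free⇒path-free {a} {b} {c} {d} abc bcd with a ≟ d
  ... | yes refl = proj₂ (proj₁ (proj₂ fo)) a b c abc bcd
  ... | no a≢d = proj₂ (proj₂ fo) (lookup (a ∷ b ∷ c ∷ d ∷ []))
                   (λ {i} {j} → lookup-injective unique i j) hom
    where
    unique = let a≢b , a≢c , b≢c = distinct a b c abc; _ , b≢d , c≢d = distinct b c d bcd in
      (a≢b ∷ a≢c ∷ a≢d ∷ []) ∷ (b≢c ∷ b≢d ∷ []) ∷ (c≢d ∷ []) ∷ [] ∷ []
    hom : IsHom R3 E (lookup (a ∷ b ∷ c ∷ d ∷ []))
    hom 0F 0F _ ()
    hom 0F 1F 0F ()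
    hom 0F 1F 1F ()
    hom 0F 1F 2F _ = abc
    hom 0F 1F 3F ()
    hom 0F (suc (suc _)) _ ()
    hom 1F 0F 0F ()
    hom 1F 0F 1F ()
    hom 1F 0F 2F _ = trans (swap b a c) abc
    hom 1F 0F 3F ()
    hom 1F 1F _ ()
    hom 1F 2F 0F ()
    hom 1F 2F 1F ()
    hom 1F 2F 2F ()
    hom 1F 2F 3F _ = bcd
    hom 1F (suc (suc (suc _))) _ ()
    hom 2F 0F _ ()
    hom 2F 1F 0F ()
    hom 2F 1F 1F ()
    hom 2F 1F 2F ()
    hom 2F 1F 3F _ = trans (swap c b d) bcd
    hom 2F (suc (suc _)) _ ()
    hom 3F _ _ ()

-- The tail relation of a graph.

tail? : (E : Rel3 n) (a b : Fin n) → Dec (∃ λ c → E a b c ≡ true)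
tail? E a b = any? (λ c → E a b c Bool.≟ true)

-- No edge has equal tails, so the diagonal is added by hand to let an equivalence relation arise.
tailRel : Rel3 n → Fin n → Fin n → Bool
tailRel E a b = (a ≡ᵇ b) ∨ does (tail? E a b)

tailRel-refl : (E : Rel3 n) → ∀ a → tailRel E a a ≡ true
tailRel-refl E a rewrite dec-true (a ≟ a) refl = refl

module _ {E : Rel3 n} (fo : R3FreeOriented E) where
  private
    distinct = proj₁ (proj₁ fo)
    swap     = proj₂ (proj₁ fo)

  tail⇒related : ∀ {a b c} → E a b c ≡ true → tailRel E a b ≡ true
  tail⇒related {a} {b} {c} abc rewrite dec-true (tail? E a b) (c , abc) = ∨-zeroʳ (a ≡ᵇ b)

  related⇒tail : ∀ {a b} → a ≢ b → tailRel E a b ≡ true → ∃ λ c → E a b c ≡ true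
  related⇒tail {a} {b} a≢b rab rewrite dec-false (a ≟ b) a≢b with tail? E a b
  ... | yes tail = tail

  tailRel-sym : ∀ a b → tailRel E a b ≡ tailRel E b a
  tailRel-sym a b with a ≟ b
  ... | yes refl = sym (tailRel-refl E a)
  ... | no a≢b rewrite dec-false (b ≟ a) (a≢b ∘ sym) with tail? E a b
  ...   | yes (c , abc) = sym (dec-true (tail? E b a) (c , trans (swap b a c) abc))
  ...   | no ¬tail = sym (dec-false (tail? E b a) (λ { (c , bac) → ¬tail (c , trans (swap a b c) bac) }))

  -- Since b and c are distinct, being related would make them the tails of some bc → d, which
  -- continues ab → c to a forbidden path.
  head-unrelated : ∀ {a b c} → E a b c ≡ true → tailRel E b c ≡ false
  head-unrelated {a} {b} {c} abc = ≢true⇒≡false λ rbc →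
    R3-free⇒path-free fo abc (proj₂ (related⇒tail (proj₂ (proj₂ (distinct a b c abc))) rbc))

  edge⇒graphOf-tailRel : ∀ {a b c} → E a b c ≡ true → graphOf (tailRel E) a b c ≡ true
  edge⇒graphOf-tailRel {a} {b} {c} abc = graphOf⁺ (tailRel E) (proj₁ (distinct a b c abc)) (tail⇒related abc)
    -- Exchanging the tails carries `head-unrelated` over from b to a.
    (head-unrelated (trans (swap b a c) abc)) (head-unrelated abc)

  ⟦edge⟧≤⟦graphOf-tailRel⟧ : ∀ a b c → ⟦ E a b c ⟧ ≤ ⟦ graphOf (tailRel E) a b c ⟧
  ⟦edge⟧≤⟦graphOf-tailRel⟧ a b c with E a b c in abc
  ... | false = z≤n
  ... | true  = ≤-reflexive (cong ⟦_⟧ (sym (edge⇒graphOf-tailRel abc)))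

  orderedCount-≤ : orderedCount E ≤ orderedCount (graphOf (tailRel E))
  orderedCount-≤ = sum-mono-≤ λ a → sum-mono-≤ λ b → sum-mono-≤ (⟦edge⟧≤⟦graphOf-tailRel⟧ a b)

  -- Equal totals are squeezed through the three nested sums, outermost first, down to single
  -- indicators.
  orderedCount-≡⇒≗ : orderedCount (graphOf (tailRel E)) ≤ orderedCount E →
    ∀ a b c → E a b c ≡ graphOf (tailRel E) a b c
  orderedCount-≡⇒≗ ≥ a b c = ⟦⟧-injective (
    sum-squeeze (⟦edge⟧≤⟦graphOf-tailRel⟧ a b) (≤-reflexive (sym (
      sum-squeeze (λ b → sum-mono-≤ (⟦edge⟧≤⟦graphOf-tailRel⟧ a b)) (≤-reflexive (sym (
        sum-squeeze (λ a → sum-mono-≤ λ b → sum-mono-≤ (⟦edge⟧≤⟦graphOf-tailRel⟧ a b)) ≥ a))) b))) c)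

-- Disjoint counts, and products of two numbers with a fixed sum.

count≤n : (p : Fin n → Bool) → count p ≤ n
count≤n p = m+n≤o⇒m≤o (count p) (≤-reflexive (count-not p))

count-disjoint : (p q : Fin n → Bool) → (∀ i → p i ≡ true → q i ≡ true → ⊥) →
  count p + count q ≡ count (λ i → p i ∨ q i)
count-disjoint {n} p q disj = trans (sym (∑-distrib-+ {n} _ _)) (sum-cong-≗ {n} pointwise)
  where
  pointwise : ∀ i → ⟦ p i ⟧ + ⟦ q i ⟧ ≡ ⟦ p i ∨ q i ⟧
  pointwise i with p i in pᵢ | q i in qᵢ
  ... | true  | true  = ⊥-elim (disj i pᵢ qᵢ)
  ... | true  | false = refl
  ... | false | _     = refl

_==_ : Bool → Bool → Bool
x == y = does (x Bool.≟ y)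

m*[1+m]≡0⇒m≡0 : ∀ x → x * suc x ≡ 0 → x ≡ 0
m*[1+m]≡0⇒m≡0 zero _ = refl

m*m≤1⇒m≤1 : ∀ m → m * m ≤ 1 → m ≤ 1
m*m≤1⇒m≤1 zero          _ = z≤n
m*m≤1⇒m≤1 (suc zero)    _ = ≤-refl
m*m≤1⇒m≤1 (suc (suc m)) (s≤s ())

-- Put x = j - d. Then e = j + 1 + x, and (j - x)(j + 1 + x) falls short of j (j + 1) by x (x + 1).
product-below : ∀ {d e j} → d ≤ j → d + e ≡ suc (j + j) → ∃ λ x → j ≡ d + x × d * e + x * suc x ≡ j * suc j
product-below {d} {e} {j} d≤j eq with x ← j ∸ d | refl ← m+[n∸m]≡n d≤j = x , refl , (begin
  d * e + x * suc x                  ≡⟨ cong (λ e → d * e + x * suc x) e≡ ⟩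
  d * suc (d + (x + x)) + x * suc x  ≡⟨ solve 2 (λ d x → d :* (con 1 :+ (d :+ (x :+ x))) :+ x :* (con 1 :+ x) := (d :+ x) :* (con 1 :+ (d :+ x))) refl d x ⟩
  (d + x) * suc (d + x)              ∎)
  where
  open ≡-Reasoning
  e≡ : e ≡ suc (d + (x + x))
  e≡ = +-cancelˡ-≡ d e _ (trans eq (solve 2 (λ d x → con 1 :+ ((d :+ x) :+ (d :+ x)) := d :+ (con 1 :+ (d :+ (x :+ x)))) refl d x))

-- If d > j then e ≤ j, and `product-below` applies with d and e exchanged. The maximum occurs only
-- at d = j and d = j + 1; what is kept of this is the lower bound on d, which will bound class
-- sizes from below.
product-odd-sum : ∀ d e j → d + e ≡ suc (j + j) → d * e ≤ j * suc j × (d * e ≡ j * suc j → j ≤ d)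
product-odd-sum d e j eq with d ≤? j
... | yes d≤j with x , refl , id ← product-below d≤j eq =
    m+n≤o⇒m≤o (d * e) (≤-reflexive id)
  , λ max → ≤-reflexive (trans (cong (d +_) (m*[1+m]≡0⇒m≡0 x (slack≡0 max id))) (+-identityʳ d))
  where
  slack≡0 : ∀ {l m y} → l ≡ m → l + y ≡ m → y ≡ 0
  slack≡0 {l} refl eq = +-cancelˡ-≡ l _ 0 (trans eq (sym (+-identityʳ l)))
... | no d≰j with x , _ , id ← product-below {e} {d} (+-cancelˡ-≤ (suc j) e j (≤-trans (+-monoˡ-≤ e (≰⇒> d≰j)) (≤-reflexive eq))) (trans (+-comm e d) eq) =
    m+n≤o⇒m≤o (d * e) (≤-reflexive (trans (cong (_+ x * suc x) (*-comm d e)) id)) , λ _ → <⇒≤ (≰⇒> d≰j)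

-- This is (k - x)(k + x) = k² - x², with the absolute difference covering d on either side of k.
product-even-sum : ∀ d e k → d + e ≡ k + k → d * e + ∣ d - k ∣ * ∣ d - k ∣ ≡ k * k
product-even-sum d e k eq with ≤-total d k
... | inj₁ d≤k with x ← k ∸ d | refl ← m+[n∸m]≡n d≤k
      with refl ← +-cancelˡ-≡ d e (d + x + x) (trans eq (solve 2 (λ d x → (d :+ x) :+ (d :+ x) := d :+ (d :+ x :+ x)) refl d x))
  rewrite ∣m-m+n∣≡n d x = solve 2 (λ d x → d :* (d :+ x :+ x) :+ x :* x := (d :+ x) :* (d :+ x)) refl d x
... | inj₂ k≤d with x ← d ∸ k | refl ← m+[n∸m]≡n k≤d
      with refl ← +-cancelˡ-≡ k (x + e) k (trans (sym (+-assoc k x e)) eq)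
  rewrite trans (∣-∣-comm (x + e + x) (x + e)) (∣m-m+n∣≡n (x + e) x)
  = solve 2 (λ e x → (x :+ e :+ x) :* e :+ x :* x := (x :+ e) :* (x :+ e)) refl e x

-- Degrees and failures of transitivity.

Bipartition : (Fin n → Fin n → Bool) → ℕ → Set
Bipartition {n} r m = Σ (Fin n → Bool) λ side → count side ≡ m × ∀ a b → r a b ≡ (side a == side b)

module Counting {n} (r : Fin n → Fin n → Bool) (r-refl : ∀ a → r a a ≡ true) (r-sym : ∀ a b → r a b ≡ r b a) where

  size deg codeg : Fin n → ℕ
  size a  = count (r a)
  deg a   = count (λ b → not (a ≡ᵇ b) ∧ r a b)
  codeg a = count (not ∘ r a)

  size≡1+deg : ∀ a → size a ≡ suc (deg a)
  size≡1+deg a = trans (sum-cong-≗ {n} pointwise) (trans (∑-distrib-+ {n} _ _) (cong (_+ deg a) (count-≡ᵇ a)))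
    where
    pointwise : ∀ b → ⟦ r a b ⟧ ≡ ⟦ a ≡ᵇ b ⟧ + ⟦ not (a ≡ᵇ b) ∧ r a b ⟧
    pointwise b with a ≟ b
    ... | yes refl = cong ⟦_⟧ (r-refl a)
    ... | no _     = refl

  1+deg+codeg≡n : ∀ a → suc (deg a + codeg a) ≡ n
  1+deg+codeg≡n a = trans (cong (_+ codeg a) (sym (size≡1+deg a))) (count-not (r a))

  -- Counts the witnesses b that transitivity fails from a to c.
  detours : Fin n → Fin n → ℕ
  detours a c = count (λ b → r a b ∧ not (r a c) ∧ r b c)

  -- Fix a, and pair a vertex b ≠ a related to a with a vertex c unrelated to a. If b and c are
  -- unrelated, this is an edge ab → c; otherwise it is a detour from a to c. No detour has b = a,
  -- as c would be both related and unrelated to a.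
  orderedCount+detours : orderedCount (graphOf r) + sum (λ a → sum (detours a)) ≡ sum (λ a → deg a * codeg a)
  orderedCount+detours = trans (sym (∑-distrib-+ {n} _ _)) (sum-cong-≗ {n} λ a → sym (begin
    deg a * codeg a
      ≡⟨ sum-*-sum {n} {n} _ _ ⟩
    sum (λ b → sum (λ c → ⟦ not (a ≡ᵇ b) ∧ r a b ⟧ * ⟦ not (r a c) ⟧))
      ≡⟨ sum-cong-≗ {n} (λ b → trans (sum-cong-≗ {n} (pointwise a b)) (∑-distrib-+ {n} _ _)) ⟩
    sum (λ b → sum (λ c → ⟦ graphOf r a b c ⟧) + sum (λ c → ⟦ r a b ∧ not (r a c) ∧ r b c ⟧))
      ≡⟨ ∑-distrib-+ {n} _ _ ⟩
    sum (λ b → sum (λ c → ⟦ graphOf r a b c ⟧)) + sum (λ b → sum (λ c → ⟦ r a b ∧ not (r a c) ∧ r b c ⟧))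
      ≡⟨ cong (sum (λ b → sum (λ c → ⟦ graphOf r a b c ⟧)) +_) (∑-comm {n} {n} _) ⟩
    sum (λ b → sum (λ c → ⟦ graphOf r a b c ⟧)) + sum (detours a) ∎))
    where
    open ≡-Reasoning
    pointwise : ∀ a b c → ⟦ not (a ≡ᵇ b) ∧ r a b ⟧ * ⟦ not (r a c) ⟧ ≡
      ⟦ graphOf r a b c ⟧ + ⟦ r a b ∧ not (r a c) ∧ r b c ⟧
    pointwise a b c with a ≟ b
    ... | yes refl rewrite r-refl a with r a c
    ...   | true  = refl
    ...   | false = refl
    pointwise a b c | no _ with r a b | r a c | r b c
    ... | false | _     | _     = refl
    ... | true  | true  | _     = refl
    ... | true  | false | true  = refl
    ... | true  | false | false = refl

  -- A detour read backwards is a detour with the same middle vertex.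
  detours-sym : ∀ a c → detours a c ≡ detours c a
  detours-sym a c = sum-cong-≗ {n} λ b → cong ⟦_⟧ (pointwise b)
    where
    pointwise : ∀ b → r a b ∧ not (r a c) ∧ r b c ≡ r c b ∧ not (r c a) ∧ r b a
    pointwise b rewrite r-sym c b | r-sym c a | r-sym b a with r a b | r a c | r b c
    ... | true  | true  | true  = refl
    ... | true  | true  | false = refl
    ... | true  | false | true  = refl
    ... | true  | false | false = refl
    ... | false | true  | true  = refl
    ... | false | true  | false = refl
    ... | false | false | true  = refl
    ... | false | false | false = refl

  detours-related : ∀ {a c} → r a c ≡ true → detours a c ≡ 0
  detours-related {a} {c} rac rewrite rac =
    trans (sum-cong-≗ {n} (λ b → cong ⟦_⟧ (∧-zeroʳ (r a b)))) (sum-zero n)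

  detours≡0⇒disjoint : ∀ {a c} → r a c ≡ false → detours a c ≡ 0 → ∀ b → r a b ≡ true → r c b ≡ true → ⊥
  detours≡0⇒disjoint {a} {c} rac none b rab rcb =
    true≢false (cong₂ _∧_ rab (cong₂ _∧_ (cong not rac) (trans (r-sym b c) rcb)))
      (⟦⟧≡0⇒false (sum≡0⇒term≡0 (λ b → ⟦ r a b ∧ not (r a c) ∧ r b c ⟧) none b))

  Transitive : Set
  Transitive = ∀ {a b c} → r a b ≡ true → r b c ≡ true → r a c ≡ true

  no-detours⇒transitive : sum (λ a → sum (detours a)) ≡ 0 → Transitive
  no-detours⇒transitive none {a} {b} {c} rab rbc with r a c in rac
  ... | true  = refl
  ... | false = ⊥-elim (detours≡0⇒disjoint rac
    (sum≡0⇒term≡0 (detours a) (sum≡0⇒term≡0 (λ a → sum (detours a)) none a) c) b rab (trans (r-sym c b) rbc))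

  module _ (r-trans : Transitive) where

    classes-disjoint : ∀ {a c} → r a c ≡ false → ∀ b → r a b ≡ true → r c b ≡ true → ⊥
    classes-disjoint {a} {c} rac b rab rcb = true≢false (r-trans rab (trans (r-sym b c) rcb)) rac

    -- Two unrelated vertices outside the class of v would have disjoint classes there, of at least
    -- k + 1 vertices each, but only k + 1 vertices remain. So all vertices outside form one class.
    two-classes : ∀ {v k} → size v + suc k ≡ n → (∀ a → suc k ≤ size a) → ∀ a b → r a b ≡ (r v a == r v b)
    two-classes {v} {k} size-v large a b with r v a in rva | r v b in rvb
    ... | true  | true  = r-trans (trans (r-sym a v) rva) rvb
    ... | true  | false = ≢true⇒≡false λ rab → true≢false (r-trans rva rab) rvb
    ... | false | true  = ≢true⇒≡false λ rab → true≢false (r-trans rvb (trans (r-sym b a) rab)) rva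
    ... | false | false with r a b in rab
    ...   | true  = refl
    ...   | false = contradiction (begin-strict
      size v + suc k                                 <⟨ +-monoʳ-< (size v) (m<m+n (suc k) (s≤s z≤n)) ⟩
      size v + (suc k + suc k)                       ≤⟨ +-monoʳ-≤ (size v) (+-mono-≤ (large a) (large b)) ⟩
      size v + (size a + size b)                     ≡⟨ cong (size v +_) (count-disjoint (r a) (r b) (classes-disjoint rab)) ⟩
      size v + count (λ i → r a i ∨ r b i)           ≡⟨ count-disjoint (r v) _ disj ⟩
      count (λ i → r v i ∨ r a i ∨ r b i)            ≤⟨ count≤n _ ⟩
      n                                              ≡⟨ size-v ⟨
      size v + suc k                                 ∎) (<-irrefl refl)
      where
      open ≤-Reasoning
      disj : ∀ i → r v i ≡ true → r a i ∨ r b i ≡ true → ⊥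
      disj i rvi e with r a i in rai
      ... | true  = classes-disjoint rva i rvi rai
      ... | false = classes-disjoint rvb i rvi e

  -- An even number of vertices.

  module Even {j} (n≡ : n ≡ suc j + suc j) where

    deg+codeg : ∀ a → deg a + codeg a ≡ suc (j + j)
    deg+codeg a = suc-injective (trans (1+deg+codeg≡n a) (trans n≡ (cong suc (+-suc j j))))

    pointwise-≤ : ∀ a → deg a * codeg a ≤ j * suc j
    pointwise-≤ a = proj₁ (product-odd-sum (deg a) (codeg a) j (deg+codeg a))

    total : orderedCount (graphOf r) + sum (λ a → sum (detours a)) ≤ n * (j * suc j)
    total = ≤-trans (≤-reflexive orderedCount+detours) (≤-trans (sum-mono-≤ pointwise-≤) (≤-reflexive (sum-const n _)))

    upper-bound : orderedCount (graphOf r) ≤ n * (j * suc j)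
    upper-bound = m+n≤o⇒m≤o _ total

    -- For j = 0 the maximum is 0, and two related vertices attain it without splitting into two
    -- sides.
    module _ (1≤j : 1 ≤ j) (max : orderedCount (graphOf r) ≡ n * (j * suc j)) where

      transitive : Transitive
      -- The bound covers edges and detours together, so a maximal edge count leaves no room for
      -- detours.
      transitive = no-detours⇒transitive (n≤0⇒n≡0 (+-cancelˡ-≤ (orderedCount (graphOf r)) _ 0
        (≤-trans total (≤-reflexive (trans (sym max) (sym (+-identityʳ _)))))))

      products-max : ∀ a → deg a * codeg a ≡ j * suc j
      products-max = sum-squeeze pointwise-≤ (begin
        sum {n} (λ _ → j * suc j)                                        ≡⟨ sum-const n _ ⟩
        n * (j * suc j)                                                  ≡⟨ max ⟨
        orderedCount (graphOf r)                                         ≤⟨ m≤m+n _ _ ⟩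
        orderedCount (graphOf r) + sum (λ a → sum (detours a))           ≡⟨ orderedCount+detours ⟩
        sum (λ a → deg a * codeg a)                                      ∎)
        where open ≤-Reasoning

      large : ∀ a → suc j ≤ size a
      large a = ≤-trans (s≤s (proj₂ (product-odd-sum (deg a) (codeg a) j (deg+codeg a)) (products-max a))) (≤-reflexive (sym (size≡1+deg a)))

      codeg≢0 : ∀ a → codeg a ≢ 0
      codeg≢0 a eq = <⇒≢ 1≤j (sym (m*[1+m]≡0⇒m≡0 j (trans (sym (products-max a)) (trans (cong (deg a *_) eq) (*-zeroʳ (deg a))))))

      -- Some u is unrelated to a. Both classes have at least j + 1 vertices and are disjoint, so
      -- they fill the 2j + 2 vertices exactly.
      size-max : ∀ a → size a ≡ suc j
      size-max a with codeg a in eq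
      ... | zero  = contradiction eq (codeg≢0 a)
      ... | suc _ with u , ¬rau ← count-witness (not ∘ r a) eq =
        ≤-antisym (+-cancelʳ-≤ (suc j) (size a) (suc j) (begin
          size a + suc j                    ≤⟨ +-monoʳ-≤ (size a) (large u) ⟩
          size a + size u                   ≡⟨ count-disjoint (r a) (r u) (classes-disjoint transitive (not-injective ¬rau)) ⟩
          count (λ i → r a i ∨ r u i)       ≤⟨ count≤n _ ⟩
          n                                 ≡⟨ n≡ ⟩
          suc j + suc j                     ∎)) (large a)
        where open ≤-Reasoning

      bipartition : Bipartition r (suc j)
      bipartition = r v , size-max v , two-classes transitive (trans (cong (_+ suc j) (size-max v)) (sym n≡)) large
        where v = subst Fin (sym n≡) zero

  -- An odd number of vertices.

  module Odd {k} (n≡ : n ≡ k + suc k) where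

    -- The amount by which deg a * codeg a falls below k².
    loss : Fin n → ℕ
    loss a = ∣ deg a - k ∣ * ∣ deg a - k ∣

    deg+codeg : ∀ a → deg a + codeg a ≡ k + k
    deg+codeg a = suc-injective (trans (1+deg+codeg≡n a) (trans n≡ (+-suc k k)))

    total : orderedCount (graphOf r) + (sum (λ a → sum (detours a)) + sum loss) ≡ n * (k * k)
    total = begin
      orderedCount (graphOf r) + (sum (λ a → sum (detours a)) + sum loss)  ≡⟨ +-assoc (orderedCount (graphOf r)) _ _ ⟨
      orderedCount (graphOf r) + sum (λ a → sum (detours a)) + sum loss    ≡⟨ cong (_+ sum loss) orderedCount+detours ⟩
      sum (λ a → deg a * codeg a) + sum loss                               ≡⟨ ∑-distrib-+ {n} _ _ ⟨
      sum (λ a → deg a * codeg a + loss a)                                 ≡⟨ sum-cong-≗ {n} (λ a → product-even-sum (deg a) (codeg a) k (deg+codeg a)) ⟩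
      sum {n} (λ _ → k * k)                                                ≡⟨ sum-const n (k * k) ⟩
      n * (k * k)                                                          ∎
      where open ≡-Reasoning

    loss≡0⇒balanced : ∀ a → loss a ≡ 0 → deg a ≡ k
    loss≡0⇒balanced a eq with m*n≡0⇒m≡0∨n≡0 ∣ deg a - k ∣ eq
    ... | inj₁ eq′ = ∣m-n∣≡0⇒m≡n eq′
    ... | inj₂ eq′ = ∣m-n∣≡0⇒m≡n eq′

    -- Each of the 2k + 1 vertices then loses at least 1.
    all-unbalanced : (∀ a → deg a ≢ k) → k < sum loss
    all-unbalanced unbalanced = begin-strict
      k                        <⟨ m≤n+m (suc k) k ⟩
      k + suc k                ≡⟨ n≡ ⟨
      n                        ≡⟨ *-identityʳ n ⟨
      n * 1                    ≡⟨ sum-const n 1 ⟨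
      sum {n} (λ _ → 1)        ≤⟨ sum-mono-≤ (λ a → n≢0⇒n>0 (unbalanced a ∘ loss≡0⇒balanced a)) ⟩
      sum loss                 ∎
      where open ≤-Reasoning

    module Balanced {v} (deg-v : deg v ≡ k) where

      codeg-v : codeg v ≡ k
      codeg-v = +-cancelˡ-≡ k _ _ (trans (cong (_+ codeg v) (sym deg-v)) (deg+codeg v))

      size-v : size v ≡ suc k
      size-v = trans (size≡1+deg v) (cong suc deg-v)

      -- Two unrelated vertices of degree k with disjoint classes would occupy 2k + 2 vertices.
      outside-pays : ∀ c → ⟦ not (r v c) ⟧ ≤ loss c + detours v c
      outside-pays c = ⟦not⟧≤ λ rvc → n≢0⇒n>0 λ none → <-irrefl refl (begin-strict
        k + suc k                    <⟨ n<1+n _ ⟩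
        suc k + suc k                ≡⟨ cong₂ _+_ size-v (trans (size≡1+deg c) (cong suc (loss≡0⇒balanced c (m+n≡0⇒m≡0 (loss c) none)))) ⟨
        size v + size c              ≡⟨ count-disjoint (r v) (r c) (detours≡0⇒disjoint rvc (m+n≡0⇒n≡0 (loss c) none)) ⟩
        count (λ i → r v i ∨ r c i)  ≤⟨ count≤n _ ⟩
        n                            ≡⟨ n≡ ⟩
        k + suc k                    ∎)
        where open ≤-Reasoning

      -- Exactly k vertices are unrelated to v, and each pays at least 1 by `outside-pays`.
      k≤ : k ≤ sum (detours v) + sum loss
      k≤ = begin
        k                                     ≡⟨ codeg-v ⟨
        codeg v                               ≤⟨ sum-mono-≤ outside-pays ⟩
        sum (λ c → loss c + detours v c)      ≡⟨ ∑-distrib-+ {n} _ _ ⟩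
        sum loss + sum (detours v)            ≡⟨ +-comm (sum loss) _ ⟩
        sum (detours v) + sum loss            ∎
        where open ≤-Reasoning

    deficit : k ≤ sum (λ a → sum (detours a)) + sum loss
    deficit with any? (λ v → deg v ℕ.≟ k)
    ... | yes (v , deg-v) = ≤-trans (Balanced.k≤ deg-v) (+-monoˡ-≤ (sum loss) (term≤sum (λ a → sum (detours a)) v))
    ... | no ¬balanced = ≤-trans (<⇒≤ (all-unbalanced (λ a eq → ¬balanced (a , eq)))) (m≤n+m (sum loss) _)

    upper-bound : orderedCount (graphOf r) + k ≤ n * (k * k)
    upper-bound = ≤-trans (+-monoʳ-≤ (orderedCount (graphOf r)) deficit) (≤-reflexive total)

    module _ (max : orderedCount (graphOf r) + k ≡ n * (k * k)) where

      deficit≡ : sum (λ a → sum (detours a)) + sum loss ≡ k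
      deficit≡ = +-cancelˡ-≡ (orderedCount (graphOf r)) _ _ (trans total (sym max))

      -- Without one the losses alone would exceed the deficit, which is now exactly k.
      balanced-vertex : ∃ λ v → deg v ≡ k
      balanced-vertex with any? (λ v → deg v ℕ.≟ k)
      ... | yes found = found
      ... | no ¬balanced = contradiction (m+n≤o⇒n≤o _ (≤-reflexive deficit≡)) (<⇒≱ (all-unbalanced (λ a eq → ¬balanced (a , eq))))

      private
        v = proj₁ balanced-vertex
      open Balanced (proj₂ balanced-vertex)

      -- The detours from v and the losses already use up the whole deficit k.
      detours-only-from-v : ∀ {u} → u ≢ v → sum (detours u) ≡ 0
      detours-only-from-v {u} u≢v = n≤0⇒n≡0 (+-cancelʳ-≤ (sum (detours v)) (sum (detours u)) 0
        (≤-trans (term+term≤sum (λ a → sum (detours a)) u≢v)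
          (+-cancelʳ-≤ (sum loss) _ _ (≤-trans (≤-reflexive deficit≡) k≤))))

      -- Reversed, a detour from v to some u ≠ v would start at u, where there are none.
      detours-from-v : ∀ u → detours v u ≡ 0
      detours-from-v u with u ≟ v
      ... | yes refl = detours-related (r-refl v)
      ... | no u≢v   = trans (detours-sym v u) (sum≡0⇒term≡0 (detours u) (detours-only-from-v u≢v) v)

      no-detours : ∀ u → sum (detours u) ≡ 0
      no-detours u with u ≟ v
      ... | yes refl = trans (sum-cong-≗ {n} detours-from-v) (sum-zero n)
      ... | no u≢v   = detours-only-from-v u≢v

      detours≡0 : sum (λ a → sum (detours a)) ≡ 0
      detours≡0 = trans (sum-cong-≗ {n} no-detours) (sum-zero n)

      -- With detours gone, `outside-pays` compares two functions that both sum to k, so it is an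
      -- equality everywhere.
      loss≡outside : ∀ c → ⟦ not (r v c) ⟧ ≡ loss c
      loss≡outside = sum-squeeze
        (λ c → ≤-trans (outside-pays c) (≤-reflexive (trans (cong (loss c +_) (detours-from-v c)) (+-identityʳ (loss c)))))
        (≤-reflexive (trans (trans (cong (_+ sum loss) (sym detours≡0)) deficit≡) (sym codeg-v)))

      -- A loss of at most 1 means that the degree is at least k - 1, and the class also contains a
      -- itself.
      large : ∀ a → k ≤ size a
      large a = begin
        k                       ≤⟨ m≤n+∣n-m∣ k (deg a) ⟩
        deg a + ∣ deg a - k ∣   ≤⟨ +-monoʳ-≤ (deg a) (m*m≤1⇒m≤1 _ (≤-trans (≤-reflexive (sym (loss≡outside a))) (⟦⟧≤1 (not (r v a))))) ⟩
        deg a + 1               ≡⟨ +-comm (deg a) 1 ⟩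
        suc (deg a)             ≡⟨ size≡1+deg a ⟨
        size a                  ∎
        where open ≤-Reasoning

  -- The parameter is shifted by one because `two-classes` wants a positive lower bound on class
  -- sizes: the class of v has k + 2 vertices, k + 1 remain, and every class has at least k + 1.
  odd-bipartition : ∀ {k} → n ≡ suc k + suc (suc k) → orderedCount (graphOf r) + suc k ≡ n * (suc k * suc k) →
    Bipartition r (suc (suc k))
  odd-bipartition {k} n≡ max =
    r v , size-v , two-classes (no-detours⇒transitive detours≡0)
      (trans (cong (_+ suc k) size-v) (trans (+-comm (suc (suc k)) (suc k)) (sym n≡))) large
    where
    v = proj₁ (Odd.balanced-vertex n≡ max)
    size-v = Odd.Balanced.size-v n≡ (proj₂ (Odd.balanced-vertex n≡ max))
    detours≡0 = Odd.detours≡0 n≡ max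
    large = Odd.large n≡ max

-- Graphs of two-colourings.

sideRel : (Fin n → Bool) → Fin n → Fin n → Bool
sideRel side a b = side a == side b

sideRel-refl : (side : Fin n → Bool) → ∀ a → sideRel side a a ≡ true
sideRel-refl side a = dec-true (side a Bool.≟ side a) refl

sideRel-sym : (side : Fin n → Bool) → ∀ a b → sideRel side a b ≡ sideRel side b a
sideRel-sym side a b = does-⇔ (mk⇔ sym sym) (side a Bool.≟ side b) (side b Bool.≟ side a)

sideGraph : (Fin n → Bool) → Rel3 n
sideGraph = graphOf ∘ sideRel

sideGraph-R3FreeOriented : (side : Fin n → Bool) → R3FreeOriented (sideGraph side)
sideGraph-R3FreeOriented side = graphOf-R3FreeOriented (sideRel side) (sideRel-refl side) (sideRel-sym side)

-- The ordered edge count for sides of sizes k and m. Truncation is harmless: if k + m < 2 then k *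
-- m = 0.
target : ℕ → ℕ → ℕ
target k m = k * m * (k + m ∸ 2)

target-split : ∀ k m → m * ((m ∸ 1) * k) + k * ((k ∸ 1) * m) ≡ target k m
target-split zero    m       = trans (+-identityʳ _) (trans (cong (m *_) (*-zeroʳ (m ∸ 1))) (*-zeroʳ m))
target-split (suc k) zero    rewrite *-zeroʳ k | *-zeroʳ k = refl
target-split (suc k) (suc m) rewrite +-suc k m =
  solve 2 (λ k m → (con 1 :+ m) :* (m :* (con 1 :+ k)) :+ (con 1 :+ k) :* (k :* (con 1 :+ m))
                := (con 1 :+ k) :* (con 1 :+ m) :* (k :+ m)) refl k m

sum-if : (p : Fin n → Bool) (x y : ℕ) → sum (λ i → if p i then x else y) ≡ count p * x + count (not ∘ p) * y
sum-if {n} p x y = trans (sum-cong-≗ {n} pointwise) (trans (∑-distrib-+ {n} _ _)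
  (sym (cong₂ _+_ (*-distribʳ-sum {n} x _) (*-distribʳ-sum {n} y _))))
  where
  pointwise : ∀ i → (if p i then x else y) ≡ ⟦ p i ⟧ * x + ⟦ not (p i) ⟧ * y
  pointwise i with p i
  ... | true  = sym (trans (+-identityʳ _) (+-identityʳ x))
  ... | false = sym (+-identityʳ y)

-- Lying on the same side is transitive, so there are no detours and the edges are counted by deg a
-- * codeg a: the rest of the side of a times the other side.
orderedCount-sideGraph : (side : Fin n → Bool) → orderedCount (sideGraph side) ≡ target (count (not ∘ side)) (count side)
orderedCount-sideGraph {n} side = begin
  orderedCount (sideGraph side)                                       ≡⟨ +-identityʳ _ ⟨
  orderedCount (sideGraph side) + 0                                   ≡⟨ cong (orderedCount (sideGraph side) +_) no-detours ⟨
  orderedCount (sideGraph side) + sum (λ a → sum (detours a))         ≡⟨ orderedCount+detours ⟩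
  sum (λ a → deg a * codeg a)                                         ≡⟨ sum-cong-≗ {n} (λ a → pointwise a) ⟩
  sum (λ a → if side a then (m ∸ 1) * k else (k ∸ 1) * m)             ≡⟨ sum-if side _ _ ⟩
  m * ((m ∸ 1) * k) + k * ((k ∸ 1) * m)                               ≡⟨ target-split k m ⟩
  target k m                                                          ∎
  where
  open ≡-Reasoning
  open Counting (sideRel side) (sideRel-refl side) (sideRel-sym side)
  k = count (not ∘ side)
  m = count side
  transitive : ∀ x y z → (x == y) ∧ not (x == z) ∧ (y == z) ≡ false
  transitive true  true  true  = refl
  transitive true  true  false = refl
  transitive true  false z     = refl
  transitive false true  z     = refl
  transitive false false true  = refl
  transitive false false false = refl
  no-detours : sum (λ a → sum (detours a)) ≡ 0
  no-detours = trans (sum-cong-≗ {n} λ a → trans (sum-cong-≗ {n} λ c → trans (sum-cong-≗ {n} λ b →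
    cong ⟦_⟧ (transitive (side a) (side b) (side c))) (sum-zero n)) (sum-zero n)) (sum-zero n)
  true== : ∀ x → (true == x) ≡ x
  true== true  = refl
  true== false = refl
  false== : ∀ x → (false == x) ≡ not x
  false== true  = refl
  false== false = refl
  pointwise : ∀ a → deg a * codeg a ≡ (if side a then (m ∸ 1) * k else (k ∸ 1) * m)
  pointwise a = trans (cong (λ s → (s ∸ 1) * codeg a) (sym (size≡1+deg a))) (sizes (side a))
    where
    sizes : ∀ s → (count (λ b → s == side b) ∸ 1) * count (λ b → not (s == side b)) ≡ (if s then (m ∸ 1) * k else (k ∸ 1) * m)
    sizes true = cong₂ (λ x y → (x ∸ 1) * y)
      (sum-cong-≗ {n} (λ b → cong ⟦_⟧ (true== (side b)))) (sum-cong-≗ {n} (λ b → cong (⟦_⟧ ∘ not) (true== (side b))))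
    sizes false = cong₂ (λ x y → (x ∸ 1) * y)
      (sum-cong-≗ {n} (λ b → cong ⟦_⟧ (false== (side b))))
      (sum-cong-≗ {n} (λ b → cong ⟦_⟧ (trans (cong not (false== (side b))) (not-involutive (side b)))))

-- Edges depend only on the colours and on whether the tails coincide; a colour-preserving bijection
-- respects both.
sideGraph-isomorphic : (side side′ : Fin n → Bool) → count side ≡ count side′ → Isomorphic (sideGraph side) (sideGraph side′)
sideGraph-isomorphic side side′ eq = π , λ a b c → same a b c
  where
  π = proj₁ (permutation-of-equal-count side side′ eq)
  preserves = proj₂ (permutation-of-equal-count side side′ eq)
  injective : ∀ {a b} → π ⟨$⟩ʳ a ≡ π ⟨$⟩ʳ b → a ≡ b
  injective e = trans (sym (Inverse.strictlyInverseʳ π _)) (trans (cong (Inverse.from π) e) (Inverse.strictlyInverseʳ π _))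
  same : ∀ a b c → sideGraph side a b c ≡ sideGraph side′ (π ⟨$⟩ʳ a) (π ⟨$⟩ʳ b) (π ⟨$⟩ʳ c)
  same a b c rewrite preserves a | preserves b | preserves c
    | does-⇔ (mk⇔ (cong (π ⟨$⟩ʳ_)) injective) (a ≟ b) ((π ⟨$⟩ʳ a) ≟ (π ⟨$⟩ʳ b)) = refl

side-of-count : ∀ k m → Σ (Fin (k + m) → Bool) λ side → count side ≡ m × count (not ∘ side) ≡ k
side-of-count zero    m = (λ _ → true) , trans (sum-const m 1) (*-identityʳ m) , sum-zero m
side-of-count (suc k) m with side , eq , eq′ ← side-of-count k m = false Vector.∷ side , eq , cong suc eq′

-- An edge would embed three distinct vertices into at most two.
edgeless : n ≤ 2 → {E : Rel3 n} → IsGraph E → ∀ a b c → E a b c ≡ false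
edgeless n≤2 (distinct , _) a b c = ≢true⇒≡false λ abc →
  let a≢b , a≢c , b≢c = distinct a b c abc in
  <-irrefl refl (≤-trans (injective⇒≤ λ {i} {j} →
    lookup-injective {xs = a ∷ b ∷ c ∷ []} ((a≢b ∷ a≢c ∷ []) ∷ (b≢c ∷ []) ∷ [] ∷ []) i j) n≤2)

-- Optimality for even and odd orders.

target-even : ∀ j → (suc j + suc j) * (j * suc j) ≡ target (suc j) (suc j)
target-even j rewrite +-suc j j =
  solve 1 (λ j → (con 2 :+ (j :+ j)) :* (j :* (con 1 :+ j)) := (con 1 :+ j) :* (con 1 :+ j) :* (j :+ j)) refl j

-- The k added here is the saving in `Odd.upper-bound`. The case zero is separate because the
-- subtraction of 2 truncates there.
target-odd : ∀ k → target k (suc k) + k ≡ (k + suc k) * (k * k)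
target-odd zero    = refl
target-odd (suc k) rewrite +-suc k (suc k) | +-suc k k =
  solve 1 (λ k → (con 1 :+ k) :* (con 2 :+ k) :* (con 1 :+ (k :+ k)) :+ (con 1 :+ k)
              := (con 1 :+ (con 2 :+ (k :+ k))) :* ((con 1 :+ k) :* (con 1 :+ k))) refl k

Bisected : Rel3 n → ℕ → Set
Bisected {n} G m = Σ (Fin n → Bool) λ side → count side ≡ m × ∀ a b c → G a b c ≡ sideGraph side a b c

-- Phrased with ordered counts, so that halving enters only at the end.
record Optimal (k m : ℕ) : Set where
  field
    bound  : ∀ {G : Rel3 (k + m)} → R3FreeOriented G → orderedCount G ≤ target k m
    unique : ∀ {G : Rel3 (k + m)} → R3FreeOriented G → orderedCount G ≡ target k m → Bisected G m

module _ {G : Rel3 n} (fo : R3FreeOriented G) where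

  bipartite : ∀ {m} → Bipartition (tailRel G) m → orderedCount (graphOf (tailRel G)) ≤ orderedCount G → Bisected G m
  bipartite (side , eq , r≡) G-full = side , eq , λ a b c → trans (orderedCount-≡⇒≗ fo G-full a b c) (same a b c)
    where
    same : ∀ a b c → graphOf (tailRel G) a b c ≡ sideGraph side a b c
    same a b c rewrite r≡ a b | r≡ a c | r≡ b c = refl

-- All graphs on so few vertices are edgeless, so any colouring with the right count describes them.
small-unique : ∀ k m → k + m ≤ 2 → {G : Rel3 (k + m)} → R3FreeOriented G → Bisected G m
small-unique k m n≤2 (graph , _) with side , eq , _ ← side-of-count k m =
  side , eq , λ a b c → trans (edgeless n≤2 graph a b c)
    (sym (edgeless n≤2 (proj₁ (sideGraph-R3FreeOriented side)) a b c))

even-optimal : ∀ k → Optimal k k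
even-optimal zero = record { bound = λ _ → z≤n ; unique = λ fo _ → small-unique 0 0 z≤n fo }
even-optimal (suc j) = record { bound = λ fo → ≤-trans (orderedCount-≤ fo) (upper j fo) ; unique = unique j }
  where
  upper : ∀ j {G : Rel3 (suc j + suc j)} → R3FreeOriented G → orderedCount (graphOf (tailRel G)) ≤ target (suc j) (suc j)
  upper j {G} fo = ≤-trans (Counting.Even.upper-bound (tailRel G) (tailRel-refl G) (tailRel-sym fo) refl)
    (≤-reflexive (target-even j))
  unique : ∀ j {G : Rel3 (suc j + suc j)} → R3FreeOriented G → orderedCount G ≡ target (suc j) (suc j) → Bisected G (suc j)
  unique zero fo max = small-unique 1 1 ≤-refl fo
  unique (suc i) {G} fo max = bipartite fo
    (Counting.Even.bipartition (tailRel G) (tailRel-refl G) (tailRel-sym fo) refl (s≤s z≤n)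
      -- The count for the tail relation lies between that of G, which is the target, and its upper
      -- bound, again the target.
      (trans (≤-antisym (upper (suc i) fo) (≤-trans (≤-reflexive (sym max)) (orderedCount-≤ fo))) (sym (target-even (suc i)))))
    (≤-trans (upper (suc i) fo) (≤-reflexive (sym max)))

odd-optimal : ∀ k → Optimal k (suc k)
odd-optimal k = record { bound = λ fo → ≤-trans (orderedCount-≤ fo) (upper k fo) ; unique = unique k }
  where
  upper : ∀ k {G : Rel3 (k + suc k)} → R3FreeOriented G → orderedCount (graphOf (tailRel G)) ≤ target k (suc k)
  upper k {G} fo = +-cancelʳ-≤ k (orderedCount (graphOf (tailRel G))) (target k (suc k))
    (≤-trans (Counting.Odd.upper-bound (tailRel G) (tailRel-refl G) (tailRel-sym fo) refl) (≤-reflexive (sym (target-odd k))))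
  unique : ∀ k {G : Rel3 (k + suc k)} → R3FreeOriented G → orderedCount G ≡ target k (suc k) → Bisected G (suc k)
  unique zero fo max = small-unique 0 1 (s≤s z≤n) fo
  unique (suc i) {G} fo max = bipartite fo
    (Counting.odd-bipartition (tailRel G) (tailRel-refl G) (tailRel-sym fo) refl
      (trans (cong (_+ suc i) (≤-antisym (upper (suc i) fo) (≤-trans (≤-reflexive (sym max)) (orderedCount-≤ fo)))) (target-odd (suc i))))
    (≤-trans (upper (suc i) fo) (≤-reflexive (sym max)))

-- Halving and the closed formula.

half-even : ∀ k → (k + k) / 2 ≡ k
half-even k = trans (cong (_/ 2) (solve 1 (λ k → k :+ k := k :* con 2) refl k)) (m*n/n≡m k 2)

half-odd : ∀ k → suc (k + k) / 2 ≡ k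
half-odd k = trans (cong (λ x → suc x / 2) (solve 1 (λ k → k :+ k := k :* con 2) refl k))
  (trans (+-distrib-/-∣ʳ 1 {d = 2} (n∣m*n k)) (m*n/n≡m k 2))

exValue-even : ∀ k → exValue (k + k) ≡ target k k / 2
exValue-even k rewrite half-even k | +-comm (k + k) 1 | half-odd k = refl

exValue-odd : ∀ k → exValue (k + suc k) ≡ target k (suc k) / 2
exValue-odd k = cong₂ (λ x y → (x * y * (k + suc k ∸ 2)) / 2)
  (trans (cong (_/ 2) (+-suc k k)) (half-odd k))
  (trans (cong (_/ 2) (+-comm (k + suc k) 1)) (half-even (suc k)))

halves : ∀ n → (∃ λ k → k + k ≡ n) ⊎ (∃ λ k → k + suc k ≡ n)
halves zero = inj₁ (0 , refl)
halves (suc n) with halves n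
... | inj₁ (k , refl) = inj₂ (k , +-suc k k)
... | inj₂ (k , refl) = inj₁ (suc k , refl)

Isomorphic-resp-≗ : {G G′ H H′ : Rel3 n} → (∀ a b c → G a b c ≡ G′ a b c) → (∀ a b c → H a b c ≡ H′ a b c) →
  Isomorphic G′ H′ → Isomorphic G H
Isomorphic-resp-≗ G≗G′ H≗H′ (π , iso) = π , λ a b c → trans (G≗G′ a b c) (trans (iso a b c) (sym (H≗H′ _ _ _)))

-- From ordered counts to the extremal number.

Extremal : ℕ → Set
Extremal n =
    ((G : Rel3 n) → R3FreeOriented G → numEdges G ≤ exValue n) ×
    Σ (Rel3 n) (λ G → R3FreeOriented G × numEdges G ≡ exValue n) ×
    ((G H : Rel3 n) → R3FreeOriented G → numEdges G ≡ exValue n →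
      R3FreeOriented H → numEdges H ≡ exValue n → Isomorphic G H)

optimal⇒extremal : ∀ k m → Optimal k m → exValue (k + m) ≡ target k m / 2 → Extremal (k + m)
optimal⇒extremal k m optimal ex≡ = upper , (G₀ , fo₀ , G₀-edges) , isomorphic
  where
  open Optimal optimal
  side₀ = proj₁ (side-of-count k m)
  G₀ = sideGraph side₀
  fo₀ = sideGraph-R3FreeOriented side₀
  -- The extremal example itself shows that the target is even, so the division by 2 in `exValue` is
  -- exact.
  target≡ : target k m ≡ numEdges G₀ * 2
  target≡ = trans (sym (cong₂ target (proj₂ (proj₂ (side-of-count k m))) (proj₁ (proj₂ (side-of-count k m)))))
    (trans (sym (orderedCount-sideGraph side₀)) (orderedCount≡2*numEdges (proj₁ fo₀)))
  G₀-edges : numEdges G₀ ≡ exValue (k + m)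
  G₀-edges = sym (trans ex≡ (trans (cong (_/ 2) target≡) (m*n/n≡m (numEdges G₀) 2)))
  upper : (G : Rel3 (k + m)) → R3FreeOriented G → numEdges G ≤ exValue (k + m)
  upper G fo = ≤-trans (*-cancelʳ-≤ (numEdges G) (numEdges G₀) 2
    (≤-trans (≤-reflexive (sym (orderedCount≡2*numEdges (proj₁ fo)))) (≤-trans (bound fo) (≤-reflexive target≡))))
    (≤-reflexive G₀-edges)
  bisected : (G : Rel3 (k + m)) → R3FreeOriented G → numEdges G ≡ exValue (k + m) → Bisected G m
  bisected G fo max = unique fo
    (trans (orderedCount≡2*numEdges (proj₁ fo)) (trans (cong (_* 2) (trans max (sym G₀-edges))) (sym target≡)))
  isomorphic : (G H : Rel3 (k + m)) → R3FreeOriented G → numEdges G ≡ exValue (k + m) →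
    R3FreeOriented H → numEdges H ≡ exValue (k + m) → Isomorphic G H
  isomorphic G H foG maxG foH maxH
    with side , eq , G≗ ← bisected G foG maxG | side′ , eq′ , H≗ ← bisected H foH maxH =
    Isomorphic-resp-≗ G≗ H≗ (sideGraph-isomorphic side side′ (trans eq (sym eq′)))

theorem2 : (n : ℕ) →
    ((G : Rel3 n) → R3FreeOriented G → numEdges G ≤ exValue n) ×
    Σ (Rel3 n) (λ G → R3FreeOriented G × numEdges G ≡ exValue n) ×
    ((G H : Rel3 n) → R3FreeOriented G → numEdges G ≡ exValue n →
    R3FreeOriented H → numEdges H ≡ exValue n → Isomorphic G H)
theorem2 n with halves n
... | inj₁ (k , refl) = optimal⇒extremal k k (even-optimal k) (exValue-even k)
... | inj₂ (k , refl) = optimal⇒extremal k (suc k) (odd-optimal k) (exValue-odd k)
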